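{- Let $n\ge 1$ and $0\le k\le n$ be integers. Then $$\begin{aligned}\begin{bmatrix} n\\ k\end{bmatrix}_{\mathcal{F}}={}&\sum_{i=0}^{n-k-2}\left\{ q^{F_{k+1}F_{n-k-i}}\,[F_{n-k-i-1}]_{q^{F_{k}}}\left(\prod_{j=1}^{i}[F_{k+1}]_{q^{F_{n-k-j+1}}}\right)\begin{bmatrix} n-i-1\\ k-1\end{bmatrix}_{\mathcal{F}}\right\}\\ &+\prod_{j=1}^{n-k}[F_{k+1}]_{q^{F_{n-k-j+1}}}.\end{aligned}$$
   Context: Fibonacci numbers: $F_0=0$, $F_1=1$, $F_n=F_{n-1}+F_{n-2}$. For an integer $m\ge 0$, $[m]_q=\sum_{i=0}^{m-1}q^i$ (so $[0]_q=0$), with $q$ an indeterminate, and $[m]_{q^s}=\sum_{i=0}^{m-1}q^{si}$ for an integer $s\ge 0$ (so $[m]_{q^0}=m$). Put $[F_m]_q!=\prod_{i=1}^m [F_i]_q$ (with $[F_0]_q!=1$). The $q$-Fibonomial coefficient is, for integers $0\le k\le n$, $$\begin{bmatrix} n\\ k\end{bmatrix}_{\mathcal{F}}=\frac{[F_n]_q!}{[F_k]_q!\,[F_{n-k}]_q!},$$ and it is $0$ if $k<0$. Empty sums (including those whose upper limit is less than the lower limit) are $0$ and empty products are $1$. -}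

module Defs where

open import Algebra.Bundles.Raw using (RawSemiring)
import Algebra.Definitions.RawSemiring as RawSemiringDefinitions
open import Data.Fin.Base using (Fin; zero; suc; toℕ)
open import Data.Integer.Base as ℤ using (ℤ; +_; -[1+_]; 0ℤ; 1ℤ)
import Data.Integer.Properties as ℤₚ
open import Data.List.Base using (List; []; _∷_; map)
open import Data.Nat.Base as ℕ using (ℕ; zero; suc; _∸_)
open import Data.Product.Base using (∃; _,_)
open import Data.Sum.Base using (_⊎_; inj₁; inj₂; [_,_]′)
open import Data.Vec.Functional using (Vector)
open import Level using (0ℓ)
open import Relation.Binary.PropositionalEquality
open import Relation.Nullary using (¬_; yes; no; contradiction)

------------------------------------------------------------------------
-- The polynomial ring ℤ[q]

-- The head of the list is the constant coefficient.  Trailing zeros are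
-- allowed, so equality of polynomials is `_≈ₚ_` and not `_≡_`.
Poly : Set
Poly = List ℤ

coeff : Poly → ℕ → ℤ
coeff []      _       = 0ℤ
coeff (a ∷ p) zero    = a
coeff (a ∷ p) (suc i) = coeff p i

infix 4 _≈ₚ_

_≈ₚ_ : Poly → Poly → Set
p ≈ₚ r = ∀ i → coeff p i ≡ coeff r i

infixl 6 _+ₚ_
infixl 7 _*ₚ_

_+ₚ_ : Poly → Poly → Poly
[]      +ₚ r       = r
(a ∷ p) +ₚ []      = a ∷ p
(a ∷ p) +ₚ (b ∷ r) = (a ℤ.+ b) ∷ (p +ₚ r)

_*ₚ_ : Poly → Poly → Poly
[]      *ₚ r = []
(a ∷ p) *ₚ r = map (a ℤ.*_) r +ₚ (0ℤ ∷ p *ₚ r)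

ℤ[q] : RawSemiring 0ℓ 0ℓ
ℤ[q] = record
  { Carrier = Poly
  ; _≈_     = _≈ₚ_
  ; _+_     = _+ₚ_
  ; _*_     = _*ₚ_
  ; 0#      = []
  ; 1#      = 1ℤ ∷ []
  }

module ℤ[q] where
  open RawSemiring ℤ[q] public
  open RawSemiringDefinitions ℤ[q] public using (sum; product; _^_)

q : Poly
q = 0ℤ ∷ 1ℤ ∷ []

-- ℤ[q] has no zero divisors

coeff-+ : ∀ p r i → coeff (p +ₚ r) i ≡ coeff p i ℤ.+ coeff r i
coeff-+ []      r       i       = sym (ℤₚ.+-identityˡ _)
coeff-+ (a ∷ p) []      i       = sym (ℤₚ.+-identityʳ _)
coeff-+ (a ∷ p) (b ∷ r) zero    = refl
coeff-+ (a ∷ p) (b ∷ r) (suc i) = coeff-+ p r i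

coeff-map : ∀ a r i → coeff (map (a ℤ.*_) r) i ≡ a ℤ.* coeff r i
coeff-map a []      i       = sym (ℤₚ.*-zeroʳ a)
coeff-map a (b ∷ r) zero    = refl
coeff-map a (b ∷ r) (suc i) = coeff-map a r i

coeff-* : ∀ a p r i →
          coeff ((a ∷ p) *ₚ r) i ≡ a ℤ.* coeff r i ℤ.+ coeff (0ℤ ∷ p *ₚ r) i
coeff-* a p r i = trans (coeff-+ (map (a ℤ.*_) r) (0ℤ ∷ p *ₚ r) i)
                        (cong (ℤ._+ _) (coeff-map a r i))

*-shiftʳ : ∀ p r → p *ₚ (0ℤ ∷ r) ≈ₚ 0ℤ ∷ p *ₚ r
*-shiftʳ []      r zero    = refl
*-shiftʳ []      r (suc i) = refl
*-shiftʳ (a ∷ p) r zero    =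
  trans (coeff-* a p (0ℤ ∷ r) zero) (trans (ℤₚ.+-identityʳ _) (ℤₚ.*-zeroʳ a))
*-shiftʳ (a ∷ p) r (suc i) = trans (coeff-* a p (0ℤ ∷ r) (suc i))
  (trans (cong (λ c → a ℤ.* coeff r i ℤ.+ c) (*-shiftʳ p r i))
         (sym (coeff-* a p r i)))

*-zero-factor-const≢0 : ∀ a p r → a ≢ 0ℤ → (a ∷ p) *ₚ r ≈ₚ [] → r ≈ₚ []
*-zero-factor-const≢0 a p []      a≢0 eq i = refl
*-zero-factor-const≢0 a p (b ∷ r) a≢0 eq
  with ℤₚ.i*j≡0⇒i≡0∨j≡0 a
         (trans (sym (ℤₚ.+-identityʳ _))
                (trans (sym (coeff-* a p (b ∷ r) zero)) (eq zero)))
... | inj₁ a≡0  = contradiction a≡0 a≢0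
... | inj₂ refl = λ where
  zero    → refl
  (suc i) → *-zero-factor-const≢0 a p r a≢0
    (λ j → trans (sym (*-shiftʳ (a ∷ p) r (suc j))) (eq (suc j))) i

*-zero-factor : ∀ p r → p *ₚ r ≈ₚ [] → p ≈ₚ [] ⊎ r ≈ₚ []
*-zero-factor []      r eq = inj₁ (λ _ → refl)
*-zero-factor (a ∷ p) r eq with a ℤₚ.≟ 0ℤ
... | no a≢0   = inj₂ (*-zero-factor-const≢0 a p r a≢0 eq)
... | yes refl = [ (λ p≈0 → inj₁ λ { zero → refl ; (suc i) → p≈0 i }) , inj₂ ]′
  (*-zero-factor p r λ i →
    trans (sym (ℤₚ.+-identityˡ _))
          (trans (sym (coeff-* 0ℤ p r (suc i))) (eq (suc i))))

1≉0 : ¬ (1ℤ ∷ [] ≈ₚ [])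
1≉0 eq with () ← eq 0

*-≉0 : ∀ {p r} → ¬ (p ≈ₚ []) → ¬ (r ≈ₚ []) → ¬ (p *ₚ r ≈ₚ [])
*-≉0 {p} {r} p≉0 r≉0 eq = [ p≉0 , r≉0 ]′ (*-zero-factor p r eq)

------------------------------------------------------------------------
-- The field of fractions ℚ(q) of ℤ[q]

record Frac : Set where
  constructor _/_⟨_⟩
  field
    num   : Poly
    den   : Poly
    den≉0 : den ℤ[q].≉ ℤ[q].0#

open Frac public

ℚ⟨q⟩ : RawSemiring 0ℓ 0ℓ
ℚ⟨q⟩ = record
  { Carrier = Frac
  ; _≈_     = λ x y → num x *ₚ den y ≈ₚ num y *ₚ den x
  ; _+_     = λ x y → (num x *ₚ den y +ₚ num y *ₚ den x) / den x *ₚ den y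
                        ⟨ *-≉0 {den x} {den y} (den≉0 x) (den≉0 y) ⟩
  ; _*_     = λ x y → (num x *ₚ num y) / den x *ₚ den y
                        ⟨ *-≉0 {den x} {den y} (den≉0 x) (den≉0 y) ⟩
  ; 0#      = ℤ[q].0# / ℤ[q].1# ⟨ 1≉0 ⟩
  ; 1#      = ℤ[q].1# / ℤ[q].1# ⟨ 1≉0 ⟩
  }

module ℚ⟨q⟩ where
  open RawSemiring ℚ⟨q⟩ public
  open RawSemiringDefinitions ℚ⟨q⟩ public using (sum; product; _^_)

ι : Poly → Frac
ι p = p / ℤ[q].1# ⟨ 1≉0 ⟩

-- ∑[ i < m ] f i is the sum over 0 ≤ i ≤ m - 1;
-- ∏[1≤ j ≤ m ] f j is the product over 1 ≤ j ≤ m.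

∑< : ℕ → (ℕ → Frac) → Frac
∑< m f = ℚ⟨q⟩.sum {m} (λ i → f (toℕ i))

syntax ∑< m (λ i → t) = ∑[ i < m ] t

∏₁≤ : ℕ → (ℕ → Poly) → Poly
∏₁≤ m f = ℤ[q].product {m} (λ j → f (suc (toℕ j)))

syntax ∏₁≤ m (λ j → t) = ∏[1≤ j ≤ m ] t

------------------------------------------------------------------------
-- q-Fibonomial coefficients

F : ℕ → ℕ
F 0             = 0
F 1             = 1
F (suc (suc n)) = F (suc n) ℕ.+ F n

[_]q : ℕ → Poly
[ m ]q = ℤ[q].sum {m} (λ i → q ℤ[q].^ toℕ i)

-- [ m ]q^ s is [m] with q replaced by q^s.
[_]q^_ : ℕ → ℕ → Poly
[ m ]q^ s = ℤ[q].sum {m} (λ i → q ℤ[q].^ (s ℕ.* toℕ i))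

[F_]! : ℕ → Poly
[F m ]! = ∏[1≤ i ≤ m ] [ F i ]q

F-suc : ∀ n → ∃ λ m → F (suc n) ≡ suc m
F-suc zero    = 0 , refl
F-suc (suc n) with F (suc n) | F-suc n
... | _ | m , refl = m ℕ.+ F n , refl

sum-multiples-of-q : ∀ {m} (f : Vector Poly m) →
                     coeff (ℤ[q].sum (λ i → q *ₚ f i)) 0 ≡ 0ℤ
sum-multiples-of-q {zero}  f = refl
sum-multiples-of-q {suc m} f =
  trans (coeff-+ (q *ₚ f zero) (ℤ[q].sum (λ i → q *ₚ f (suc i))) 0)
        (cong₂ ℤ._+_ (coeff-* 0ℤ (1ℤ ∷ []) (f zero) 0)
                     (sum-multiples-of-q (λ i → f (suc i))))

coeff-[1+m]q : ∀ m → coeff [ suc m ]q 0 ≡ 1ℤ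
coeff-[1+m]q m =
  trans (coeff-+ (1ℤ ∷ []) (ℤ[q].sum (λ i → q *ₚ powers i)) 0)
        (cong (λ c → 1ℤ ℤ.+ c) (sum-multiples-of-q powers))
  where
  powers : Vector Poly m
  powers i = q ℤ[q].^ toℕ i

[1+m]q≉0 : ∀ m → ¬ ([ suc m ]q ≈ₚ [])
[1+m]q≉0 m eq with () ← trans (sym (coeff-[1+m]q m)) (eq 0)

[F1+i]q≉0 : ∀ i → ¬ ([ F (suc i) ]q ≈ₚ [])
[F1+i]q≉0 i with F (suc i) | F-suc i
... | _ | m , refl = [1+m]q≉0 m

product-≉0 : ∀ {m} (f : Vector Poly m) →
             (∀ i → ¬ (f i ≈ₚ [])) → ¬ (ℤ[q].product f ≈ₚ [])
product-≉0 {zero}  f f≉0 = 1≉0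
product-≉0 {suc m} f f≉0 =
  *-≉0 {f zero} (f≉0 zero) (product-≉0 (λ i → f (suc i)) (λ i → f≉0 (suc i)))

[F_]!≉0 : ∀ m → ¬ ([F m ]! ≈ₚ [])
[F m ]!≉0 = product-≉0 {m} (λ j → [ F (suc (toℕ j)) ]q) (λ j → [F1+i]q≉0 (toℕ j))

-- The lower index is an integer because the value at -1 is needed.  For
-- k > n the value is meaningless, as n ∸ k is truncated.
fibonomial : ℕ → ℤ → Frac
fibonomial n (+ k)    = [F n ]! / [F k ]! *ₚ [F n ∸ k ]!
                          ⟨ *-≉0 {[F k ]!} {[F n ∸ k ]!} [F k ]!≉0 [F n ∸ k ]!≉0 ⟩
fibonomial n -[1+ _ ] = ℚ⟨q⟩.0#

{-# OPTIONS --safe #-}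

-- Write n = d + k.  The identity F (d + k) = F (k + 1) F d + F k F (d - 1) has the
-- q-analogue
--   [F (d + k)] = [F (k + 1)]_{q^F d} [F d] + q^(F (k + 1) F d) [F (d - 1)]_{q^F k} [F k],
-- and multiplying it by [F (n - 1)]! / ([F k]! [F d]!) gives a Pascal-type recurrence
-- expressing the coefficient at (n , k) through those at (n - 1 , k) and (n - 1 , k - 1).
-- Unfolding its first term d times yields the sum; the last of the d summands
-- contains [F 0] = 0, which is why the sum stops at i = d - 2.
module Submission where

open import Defs
open import Algebra.Bundles using (CommutativeRing; CommutativeSemiring)
open import Data.Fin.Base using (Fin; toℕ; fromℕ; inject₁)
open import Data.Fin.Properties using (toℕ-fromℕ; toℕ-inject₁)
open import Data.Integer.Base as ℤ using (ℤ; +_; 0ℤ; 1ℤ)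
import Data.Integer.Properties as ℤₚ
open import Data.List.Base using ([]; _∷_; map)
open import Data.Nat.Base using (ℕ; zero; suc; _+_; _*_; _∸_; _≤_)
import Data.Nat.Properties as ℕₚ
open import Data.Product.Base using (_,_)
open import Data.Sum.Base using (inj₁; inj₂)
open import Level using (0ℓ)
open import Relation.Binary.Bundles using (Setoid)
open import Relation.Binary.PropositionalEquality as ≡
  using (_≡_; cong; cong₂; module ≡-Reasoning)
open import Relation.Binary.Structures using (IsEquivalence)
open import Relation.Nullary using (¬_; contradiction)

-- The commutative ring ℤ[q], with every law checked coefficient by coefficient.

infixr 8 _·ₚ_

_·ₚ_ : ℤ → Poly → Poly
a ·ₚ r = map (a ℤ.*_) r

-ₚ_ : Poly → Poly
-ₚ_ = map (λ a → ℤ.- a)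

coeff-neg : ∀ p i → coeff (-ₚ p) i ≡ ℤ.- coeff p i
coeff-neg []      i       = ≡.refl
coeff-neg (a ∷ p) zero    = ≡.refl
coeff-neg (a ∷ p) (suc i) = coeff-neg p i

≈ₚ-isEquivalence : IsEquivalence _≈ₚ_
≈ₚ-isEquivalence = record
  { refl  = λ _ → ≡.refl
  ; sym   = λ p≈r i → ≡.sym (p≈r i)
  ; trans = λ p≈r r≈s i → ≡.trans (p≈r i) (r≈s i)
  }

module _ where
  open ≡-Reasoning
  open import Algebra.Definitions _≈ₚ_

  ∷-cong : ∀ {a b p r} → a ≡ b → p ≈ₚ r → (a ∷ p) ≈ₚ (b ∷ r)
  ∷-cong a≡b p≈r zero    = a≡b
  ∷-cong a≡b p≈r (suc i) = p≈r i

  -- The formula `coeff-*` leaves a tail of the form `0ℤ ∷ p *ₚ r`, that is, a polynomial multiplied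
  -- by q. Linear operations pass through this shift, so the proofs below need not split on the
  -- index i.
  coeff-∷-+ : ∀ p r i →
              coeff (0ℤ ∷ p +ₚ r) i ≡ coeff (0ℤ ∷ p) i ℤ.+ coeff (0ℤ ∷ r) i
  coeff-∷-+ p r zero    = ≡.refl
  coeff-∷-+ p r (suc i) = coeff-+ p r i

  coeff-∷-· : ∀ a p i → coeff (0ℤ ∷ a ·ₚ p) i ≡ a ℤ.* coeff (0ℤ ∷ p) i
  coeff-∷-· a p zero    = ≡.sym (ℤₚ.*-zeroʳ a)
  coeff-∷-· a p (suc i) = coeff-map a p i

  ∷-*-assoc : ∀ p r → (0ℤ ∷ p) *ₚ r ≈ₚ 0ℤ ∷ p *ₚ r
  ∷-*-assoc p r i = ≡.trans (coeff-* 0ℤ p r i) (ℤₚ.+-identityˡ _)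

  +ₚ-cong : Congruent₂ _+ₚ_
  +ₚ-cong {p} {p′} {r} {r′} p≈p′ r≈r′ i = begin
    coeff (p +ₚ r) i            ≡⟨ coeff-+ p r i ⟩
    coeff p i ℤ.+ coeff r i     ≡⟨ cong₂ ℤ._+_ (p≈p′ i) (r≈r′ i) ⟩
    coeff p′ i ℤ.+ coeff r′ i   ≡⟨ coeff-+ p′ r′ i ⟨
    coeff (p′ +ₚ r′) i          ∎

  +ₚ-assoc : Associative _+ₚ_
  +ₚ-assoc p r s i = begin
    coeff (p +ₚ r +ₚ s) i                     ≡⟨ coeff-+ (p +ₚ r) s i ⟩
    coeff (p +ₚ r) i ℤ.+ coeff s i            ≡⟨ cong (ℤ._+ _) (coeff-+ p r i) ⟩
    coeff p i ℤ.+ coeff r i ℤ.+ coeff s i     ≡⟨ ℤₚ.+-assoc (coeff p i) _ _ ⟩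
    coeff p i ℤ.+ (coeff r i ℤ.+ coeff s i)   ≡⟨ cong (λ c → coeff p i ℤ.+ c) (coeff-+ r s i) ⟨
    coeff p i ℤ.+ coeff (r +ₚ s) i            ≡⟨ coeff-+ p (r +ₚ s) i ⟨
    coeff (p +ₚ (r +ₚ s)) i                   ∎

  +ₚ-comm : Commutative _+ₚ_
  +ₚ-comm p r i = begin
    coeff (p +ₚ r) i          ≡⟨ coeff-+ p r i ⟩
    coeff p i ℤ.+ coeff r i   ≡⟨ ℤₚ.+-comm (coeff p i) _ ⟩
    coeff r i ℤ.+ coeff p i   ≡⟨ coeff-+ r p i ⟨
    coeff (r +ₚ p) i          ∎

  -ₚ-inverseˡ : LeftInverse [] -ₚ_ _+ₚ_
  -ₚ-inverseˡ p i = begin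
    coeff ((-ₚ p) +ₚ p) i             ≡⟨ coeff-+ (-ₚ p) p i ⟩
    coeff (-ₚ p) i ℤ.+ coeff p i      ≡⟨ cong (ℤ._+ coeff p i) (coeff-neg p i) ⟩
    (ℤ.- coeff p i) ℤ.+ coeff p i     ≡⟨ ℤₚ.+-inverseˡ (coeff p i) ⟩
    0ℤ                                ∎

  -ₚ-cong : Congruent₁ -ₚ_
  -ₚ-cong {p} {r} p≈r i = begin
    coeff (-ₚ p) i    ≡⟨ coeff-neg p i ⟩
    ℤ.- coeff p i     ≡⟨ cong (λ a → ℤ.- a) (p≈r i) ⟩
    ℤ.- coeff r i     ≡⟨ coeff-neg r i ⟨
    coeff (-ₚ r) i    ∎

  *ₚ-congˡ : LeftCongruent _*ₚ_
  *ₚ-congˡ {[]}    {r} {s} r≈s i = ≡.refl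
  *ₚ-congˡ {a ∷ p} {r} {s} r≈s i = begin
    coeff ((a ∷ p) *ₚ r) i                          ≡⟨ coeff-* a p r i ⟩
    a ℤ.* coeff r i ℤ.+ coeff (0ℤ ∷ p *ₚ r) i
      ≡⟨ cong₂ (λ c d → a ℤ.* c ℤ.+ d) (r≈s i) (∷-cong {0ℤ} ≡.refl (*ₚ-congˡ {p} r≈s) i) ⟩
    a ℤ.* coeff s i ℤ.+ coeff (0ℤ ∷ p *ₚ s) i       ≡⟨ coeff-* a p s i ⟨
    coeff ((a ∷ p) *ₚ s) i                          ∎

  *ₚ-zeroʳ : RightZero [] _*ₚ_
  *ₚ-zeroʳ []      i       = ≡.refl
  *ₚ-zeroʳ (a ∷ p) zero    = ≡.refl
  *ₚ-zeroʳ (a ∷ p) (suc i) = *ₚ-zeroʳ p i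

  -- Multiplication recurses on its left factor; this is the mirror image of `coeff-*`, expanding
  -- the right factor. Comparing the two expansions makes commutativity a one-step induction.
  coeff-*ʳ : ∀ p b r i →
             coeff (p *ₚ (b ∷ r)) i ≡ b ℤ.* coeff p i ℤ.+ coeff (0ℤ ∷ p *ₚ r) i
  coeff-*ʳ [] b r zero    = ≡.sym (≡.trans (ℤₚ.+-identityʳ _) (ℤₚ.*-zeroʳ b))
  coeff-*ʳ [] b r (suc i) = ≡.sym (≡.trans (ℤₚ.+-identityʳ _) (ℤₚ.*-zeroʳ b))
  coeff-*ʳ (a ∷ p) b r zero = begin
    coeff ((a ∷ p) *ₚ (b ∷ r)) 0   ≡⟨ coeff-* a p (b ∷ r) 0 ⟩
    a ℤ.* b ℤ.+ 0ℤ                 ≡⟨ cong (ℤ._+ 0ℤ) (ℤₚ.*-comm a b) ⟩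
    b ℤ.* a ℤ.+ 0ℤ                 ∎
  coeff-*ʳ (a ∷ p) b r (suc i) = begin
    coeff ((a ∷ p) *ₚ (b ∷ r)) (suc i)
      ≡⟨ coeff-* a p (b ∷ r) (suc i) ⟩
    a ℤ.* coeff r i ℤ.+ coeff (p *ₚ (b ∷ r)) i
      ≡⟨ cong (λ c → a ℤ.* coeff r i ℤ.+ c) (coeff-*ʳ p b r i) ⟩
    a ℤ.* coeff r i ℤ.+ (b ℤ.* coeff p i ℤ.+ coeff (0ℤ ∷ p *ₚ r) i)
      ≡⟨ x∙yz≈y∙xz (a ℤ.* coeff r i) (b ℤ.* coeff p i) _ ⟩
    b ℤ.* coeff p i ℤ.+ (a ℤ.* coeff r i ℤ.+ coeff (0ℤ ∷ p *ₚ r) i)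
      ≡⟨ cong (λ c → b ℤ.* coeff p i ℤ.+ c) (coeff-* a p r i) ⟨
    b ℤ.* coeff p i ℤ.+ coeff ((a ∷ p) *ₚ r) i
      ∎
    where open import Algebra.Properties.CommutativeSemigroup ℤₚ.+-commutativeSemigroup

  *ₚ-comm : Commutative _*ₚ_
  *ₚ-comm []      r i = ≡.sym (*ₚ-zeroʳ r i)
  *ₚ-comm (a ∷ p) r i = begin
    coeff ((a ∷ p) *ₚ r) i                      ≡⟨ coeff-* a p r i ⟩
    a ℤ.* coeff r i ℤ.+ coeff (0ℤ ∷ p *ₚ r) i
      ≡⟨ cong (λ c → a ℤ.* coeff r i ℤ.+ c) (∷-cong {0ℤ} ≡.refl (*ₚ-comm p r) i) ⟩
    a ℤ.* coeff r i ℤ.+ coeff (0ℤ ∷ r *ₚ p) i   ≡⟨ coeff-*ʳ r a p i ⟨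
    coeff (r *ₚ (a ∷ p)) i                      ∎

  *ₚ-distribˡ-+ₚ : _*ₚ_ DistributesOverˡ _+ₚ_
  *ₚ-distribˡ-+ₚ []      r s i = ≡.refl
  *ₚ-distribˡ-+ₚ (a ∷ p) r s i = begin
    coeff ((a ∷ p) *ₚ (r +ₚ s)) i
      ≡⟨ coeff-* a p (r +ₚ s) i ⟩
    a ℤ.* coeff (r +ₚ s) i ℤ.+ coeff (0ℤ ∷ p *ₚ (r +ₚ s)) i
      ≡⟨ cong₂ (λ c d → a ℤ.* c ℤ.+ d) (coeff-+ r s i)
           (≡.trans (∷-cong {0ℤ} ≡.refl (*ₚ-distribˡ-+ₚ p r s) i)
                    (coeff-∷-+ (p *ₚ r) (p *ₚ s) i)) ⟩
    a ℤ.* (coeff r i ℤ.+ coeff s i) ℤ.+ (pr ℤ.+ ps)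
      ≡⟨ cong (ℤ._+ (pr ℤ.+ ps)) (ℤₚ.*-distribˡ-+ a (coeff r i) _) ⟩
    a ℤ.* coeff r i ℤ.+ a ℤ.* coeff s i ℤ.+ (pr ℤ.+ ps)
      ≡⟨ interchange (a ℤ.* coeff r i) (a ℤ.* coeff s i) pr ps ⟩
    a ℤ.* coeff r i ℤ.+ pr ℤ.+ (a ℤ.* coeff s i ℤ.+ ps)
      ≡⟨ cong₂ ℤ._+_ (coeff-* a p r i) (coeff-* a p s i) ⟨
    coeff ((a ∷ p) *ₚ r) i ℤ.+ coeff ((a ∷ p) *ₚ s) i
      ≡⟨ coeff-+ ((a ∷ p) *ₚ r) ((a ∷ p) *ₚ s) i ⟨
    coeff ((a ∷ p) *ₚ r +ₚ (a ∷ p) *ₚ s) i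
      ∎
    where
    open import Algebra.Properties.CommutativeSemigroup ℤₚ.+-commutativeSemigroup
    pr = coeff (0ℤ ∷ p *ₚ r) i
    ps = coeff (0ℤ ∷ p *ₚ s) i

  *ₚ-distribʳ-+ₚ : _*ₚ_ DistributesOverʳ _+ₚ_
  *ₚ-distribʳ-+ₚ p r s i = begin
    coeff ((r +ₚ s) *ₚ p) i        ≡⟨ *ₚ-comm (r +ₚ s) p i ⟩
    coeff (p *ₚ (r +ₚ s)) i        ≡⟨ *ₚ-distribˡ-+ₚ p r s i ⟩
    coeff (p *ₚ r +ₚ p *ₚ s) i     ≡⟨ +ₚ-cong {p *ₚ r} {r *ₚ p} (*ₚ-comm p r) (*ₚ-comm p s) i ⟩
    coeff (r *ₚ p +ₚ s *ₚ p) i     ∎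

  ·ₚ-*ₚ-assoc : ∀ a p r → (a ·ₚ p) *ₚ r ≈ₚ a ·ₚ (p *ₚ r)
  ·ₚ-*ₚ-assoc a []      r i = ≡.refl
  ·ₚ-*ₚ-assoc a (b ∷ p) r i = begin
    coeff ((a ℤ.* b ∷ a ·ₚ p) *ₚ r) i
      ≡⟨ coeff-* (a ℤ.* b) (a ·ₚ p) r i ⟩
    a ℤ.* b ℤ.* coeff r i ℤ.+ coeff (0ℤ ∷ (a ·ₚ p) *ₚ r) i
      ≡⟨ cong₂ ℤ._+_ (ℤₚ.*-assoc a b _)
           (≡.trans (∷-cong {0ℤ} ≡.refl (·ₚ-*ₚ-assoc a p r) i) (coeff-∷-· a (p *ₚ r) i)) ⟩
    a ℤ.* (b ℤ.* coeff r i) ℤ.+ a ℤ.* coeff (0ℤ ∷ p *ₚ r) i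
      ≡⟨ ℤₚ.*-distribˡ-+ a (b ℤ.* coeff r i) _ ⟨
    a ℤ.* (b ℤ.* coeff r i ℤ.+ coeff (0ℤ ∷ p *ₚ r) i)
      ≡⟨ cong (a ℤ.*_) (coeff-* b p r i) ⟨
    a ℤ.* coeff ((b ∷ p) *ₚ r) i
      ≡⟨ coeff-map a ((b ∷ p) *ₚ r) i ⟨
    coeff (a ·ₚ ((b ∷ p) *ₚ r)) i
      ∎

  *ₚ-assoc : Associative _*ₚ_
  *ₚ-assoc []      r s i = ≡.refl
  *ₚ-assoc (a ∷ p) r s i = begin
    coeff ((a ·ₚ r +ₚ (0ℤ ∷ p *ₚ r)) *ₚ s) i
      ≡⟨ *ₚ-distribʳ-+ₚ s (a ·ₚ r) (0ℤ ∷ p *ₚ r) i ⟩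
    coeff ((a ·ₚ r) *ₚ s +ₚ (0ℤ ∷ p *ₚ r) *ₚ s) i
      ≡⟨ +ₚ-cong {(a ·ₚ r) *ₚ s} {a ·ₚ (r *ₚ s)} {(0ℤ ∷ p *ₚ r) *ₚ s} {0ℤ ∷ p *ₚ r *ₚ s}
           (·ₚ-*ₚ-assoc a r s) (∷-*-assoc (p *ₚ r) s) i ⟩
    coeff (a ·ₚ (r *ₚ s) +ₚ (0ℤ ∷ p *ₚ r *ₚ s)) i
      ≡⟨ +ₚ-cong {a ·ₚ (r *ₚ s)} {a ·ₚ (r *ₚ s)} (λ _ → ≡.refl) (∷-cong {0ℤ} ≡.refl (*ₚ-assoc p r s)) i ⟩
    coeff (a ·ₚ (r *ₚ s) +ₚ (0ℤ ∷ p *ₚ (r *ₚ s))) i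
      ∎

  *ₚ-identityˡ : LeftIdentity (1ℤ ∷ []) _*ₚ_
  *ₚ-identityˡ p i = begin
    coeff ((1ℤ ∷ []) *ₚ p) i                   ≡⟨ coeff-* 1ℤ [] p i ⟩
    1ℤ ℤ.* coeff p i ℤ.+ coeff (0ℤ ∷ []) i     ≡⟨ cong₂ ℤ._+_ (ℤₚ.*-identityˡ (coeff p i)) (0∷[]≈[] i) ⟩
    coeff p i ℤ.+ 0ℤ                           ≡⟨ ℤₚ.+-identityʳ _ ⟩
    coeff p i                                  ∎
    where
    0∷[]≈[] : 0ℤ ∷ [] ≈ₚ []
    0∷[]≈[] zero    = ≡.refl
    0∷[]≈[] (suc i) = ≡.refl

  -- Lists of different lengths can represent the same polynomial, so a recursion on the left factor
  -- cannot follow an equality there. Commutativity moves each change to the right factor.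
  *ₚ-cong : Congruent₂ _*ₚ_
  *ₚ-cong {p} {p′} {r} {r′} p≈p′ r≈r′ i = begin
    coeff (p *ₚ r) i     ≡⟨ *ₚ-congˡ {p} r≈r′ i ⟩
    coeff (p *ₚ r′) i    ≡⟨ *ₚ-comm p r′ i ⟩
    coeff (r′ *ₚ p) i    ≡⟨ *ₚ-congˡ {r′} p≈p′ i ⟩
    coeff (r′ *ₚ p′) i   ≡⟨ *ₚ-comm r′ p′ i ⟩
    coeff (p′ *ₚ r′) i   ∎

ℤ[q]-commutativeRing : CommutativeRing 0ℓ 0ℓ
ℤ[q]-commutativeRing = record
  { Carrier = Poly
  ; _≈_     = _≈ₚ_
  ; _+_     = _+ₚ_
  ; _*_     = _*ₚ_
  ; -_      = -ₚ_
  ; 0#      = []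
  ; 1#      = 1ℤ ∷ []
  ; isCommutativeRing = record
    { isRing = record
      { +-isAbelianGroup = record
        { isGroup = record
          { isMonoid = record
            { isSemigroup = record
              { isMagma = record
                { isEquivalence = ≈ₚ-isEquivalence
                ; ∙-cong = λ {p} {p′} {r} {r′} → +ₚ-cong {p} {p′} {r} {r′}
                }
              ; assoc = +ₚ-assoc
              }
            ; identity = comm∧idˡ⇒id {_∙_ = _+ₚ_} +ₚ-comm {[]} (λ _ _ → ≡.refl)
            }
          ; inverse = comm∧invˡ⇒inv {_∙_ = _+ₚ_} {_⁻¹ = -ₚ_} {e = []} +ₚ-comm -ₚ-inverseˡ
          ; ⁻¹-cong = λ {p} {r} → -ₚ-cong {p} {r}
          }
        ; comm = +ₚ-comm
        }
      ; *-cong     = λ {p} {p′} {r} {r′} → *ₚ-cong {p} {p′} {r} {r′}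
      ; *-assoc    = *ₚ-assoc
      ; *-identity = comm∧idˡ⇒id {_∙_ = _*ₚ_} *ₚ-comm *ₚ-identityˡ
      ; distrib    = *ₚ-distribˡ-+ₚ , *ₚ-distribʳ-+ₚ
      }
    ; *-comm = *ₚ-comm
    }
  }
  where
  ≈ₚ-setoid : Setoid 0ℓ 0ℓ
  ≈ₚ-setoid = record { isEquivalence = ≈ₚ-isEquivalence }
  open import Algebra.Consequences.Setoid ≈ₚ-setoid

-- Cross-multiplied identities behind the arithmetic of fractions.

-- Elements of a commutative semiring stand for numerators and denominators, so
-- that a / b ≈ c / d reads a * d ≈ c * b.
module FractionIdentities {c ℓ} (R : CommutativeSemiring c ℓ) where
  open CommutativeSemiring R renaming (_+_ to infixl 6 _⊕_; _*_ to infixl 7 _⊛_)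
  open import Algebra.Solver.Ring.NaturalCoefficients.Default R
  open import Relation.Binary.Reasoning.Setoid setoid

  -- Transitivity of equality of fractions, up to the middle denominator d, which is a common factor
  -- still to be cancelled.
  swap-denominators : ∀ a b c d e f → a ⊛ d ≈ c ⊛ b → c ⊛ f ≈ e ⊛ d →
                      (a ⊛ f) ⊛ d ≈ (e ⊛ b) ⊛ d
  swap-denominators a b c d e f ad≈cb cf≈ed = begin
    (a ⊛ f) ⊛ d   ≈⟨ solve 3 (λ a d f → (a :* f) :* d := (a :* d) :* f) refl a d f ⟩
    (a ⊛ d) ⊛ f   ≈⟨ *-congʳ ad≈cb ⟩
    (c ⊛ b) ⊛ f   ≈⟨ solve 3 (λ b c f → (c :* b) :* f := (c :* f) :* b) refl b c f ⟩
    (c ⊛ f) ⊛ b   ≈⟨ *-congʳ cf≈ed ⟩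
    (e ⊛ d) ⊛ b   ≈⟨ solve 3 (λ b d e → (e :* d) :* b := (e :* b) :* d) refl b d e ⟩
    (e ⊛ b) ⊛ d   ∎

  /-+-cong : ∀ a b a′ b′ c d c′ d′ → a ⊛ b′ ≈ a′ ⊛ b → c ⊛ d′ ≈ c′ ⊛ d →
             (a ⊛ d ⊕ c ⊛ b) ⊛ (b′ ⊛ d′) ≈ (a′ ⊛ d′ ⊕ c′ ⊛ b′) ⊛ (b ⊛ d)
  /-+-cong a b a′ b′ c d c′ d′ ab′≈a′b cd′≈c′d = begin
    (a ⊛ d ⊕ c ⊛ b) ⊛ (b′ ⊛ d′)
      ≈⟨ solve 6 (λ a b b′ c d d′ →
           (a :* d :+ c :* b) :* (b′ :* d′) := (a :* b′) :* (d :* d′) :+ (c :* d′) :* (b :* b′))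
           refl a b b′ c d d′ ⟩
    (a ⊛ b′) ⊛ (d ⊛ d′) ⊕ (c ⊛ d′) ⊛ (b ⊛ b′)
      ≈⟨ +-cong (*-congʳ ab′≈a′b) (*-congʳ cd′≈c′d) ⟩
    (a′ ⊛ b) ⊛ (d ⊛ d′) ⊕ (c′ ⊛ d) ⊛ (b ⊛ b′)
      ≈⟨ solve 6 (λ a′ b b′ c′ d d′ →
           (a′ :* b) :* (d :* d′) :+ (c′ :* d) :* (b :* b′) := (a′ :* d′ :+ c′ :* b′) :* (b :* d))
           refl a′ b b′ c′ d d′ ⟩
    (a′ ⊛ d′ ⊕ c′ ⊛ b′) ⊛ (b ⊛ d)
      ∎

  /-+-assoc : ∀ a b c d e f →
              ((a ⊛ d ⊕ c ⊛ b) ⊛ f ⊕ e ⊛ (b ⊛ d)) ⊛ (b ⊛ (d ⊛ f)) ≈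
              (a ⊛ (d ⊛ f) ⊕ (c ⊛ f ⊕ e ⊛ d) ⊛ b) ⊛ ((b ⊛ d) ⊛ f)
  /-+-assoc = solve 6 (λ a b c d e f →
    ((a :* d :+ c :* b) :* f :+ e :* (b :* d)) :* (b :* (d :* f)) :=
    (a :* (d :* f) :+ (c :* f :+ e :* d) :* b) :* ((b :* d) :* f)) refl

  /-+-identityˡ : ∀ a b → (0# ⊛ b ⊕ a ⊛ 1#) ⊛ b ≈ a ⊛ (1# ⊛ b)
  /-+-identityˡ = solve 2 (λ a b →
    (con 0 :* b :+ a :* con 1) :* b := a :* (con 1 :* b)) refl

  /-+-comm : ∀ a b c d → (a ⊛ d ⊕ c ⊛ b) ⊛ (d ⊛ b) ≈ (c ⊛ b ⊕ a ⊛ d) ⊛ (b ⊛ d)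
  /-+-comm = solve 4 (λ a b c d →
    (a :* d :+ c :* b) :* (d :* b) := (c :* b :+ a :* d) :* (b :* d)) refl

  /-*-cong : ∀ a b a′ b′ c d c′ d′ → a ⊛ b′ ≈ a′ ⊛ b → c ⊛ d′ ≈ c′ ⊛ d →
             (a ⊛ c) ⊛ (b′ ⊛ d′) ≈ (a′ ⊛ c′) ⊛ (b ⊛ d)
  /-*-cong a b a′ b′ c d c′ d′ ab′≈a′b cd′≈c′d = begin
    (a ⊛ c) ⊛ (b′ ⊛ d′)   ≈⟨ interchange a c b′ d′ ⟩
    (a ⊛ b′) ⊛ (c ⊛ d′)   ≈⟨ *-cong ab′≈a′b cd′≈c′d ⟩
    (a′ ⊛ b) ⊛ (c′ ⊛ d)   ≈⟨ interchange a′ b c′ d ⟩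
    (a′ ⊛ c′) ⊛ (b ⊛ d)   ∎
    where open import Algebra.Properties.CommutativeSemigroup *-commutativeSemigroup

  /-*-assoc : ∀ a b c d e f →
              ((a ⊛ c) ⊛ e) ⊛ (b ⊛ (d ⊛ f)) ≈ (a ⊛ (c ⊛ e)) ⊛ ((b ⊛ d) ⊛ f)
  /-*-assoc a b c d e f = *-cong (*-assoc a c e) (sym (*-assoc b d f))

  /-*-identityˡ : ∀ a b → (1# ⊛ a) ⊛ b ≈ a ⊛ (1# ⊛ b)
  /-*-identityˡ a b = trans (*-congʳ (*-comm 1# a)) (*-assoc a 1# b)

  /-distribʳ : ∀ a b c d e f →
               ((c ⊛ f ⊕ e ⊛ d) ⊛ a) ⊛ ((d ⊛ b) ⊛ (f ⊛ b)) ≈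
               ((c ⊛ a) ⊛ (f ⊛ b) ⊕ (e ⊛ a) ⊛ (d ⊛ b)) ⊛ ((d ⊛ f) ⊛ b)
  /-distribʳ = solve 6 (λ a b c d e f →
    ((c :* f :+ e :* d) :* a) :* ((d :* b) :* (f :* b)) :=
    ((c :* a) :* (f :* b) :+ (e :* a) :* (d :* b)) :* ((d :* f) :* b)) refl

  -- The hypotheses say a / b = x / m and c / d = y / m, so n / m = α (a / b) + β γ (c / d). The
  -- factors `1#` are the denominators that `ι` gives to α, β and γ.
  /-common-denominator : ∀ α β γ n m x y a b c d →
    a ⊛ m ≈ x ⊛ b → c ⊛ m ≈ y ⊛ d → n ≈ α ⊛ x ⊕ β ⊛ γ ⊛ y →
    n ⊛ ((1# ⊛ b) ⊛ (1# ⊛ 1# ⊛ d)) ≈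
    ((α ⊛ a) ⊛ (1# ⊛ 1# ⊛ d) ⊕ (β ⊛ γ ⊛ c) ⊛ (1# ⊛ b)) ⊛ m
  /-common-denominator α β γ n m x y a b c d am≈xb cm≈yd n≈ = begin
    n ⊛ ((1# ⊛ b) ⊛ (1# ⊛ 1# ⊛ d))
      ≈⟨ *-congʳ n≈ ⟩
    (α ⊛ x ⊕ β ⊛ γ ⊛ y) ⊛ ((1# ⊛ b) ⊛ (1# ⊛ 1# ⊛ d))
      ≈⟨ solve 7 (λ α β γ x y b d →
           (α :* x :+ β :* γ :* y) :* ((con 1 :* b) :* (con 1 :* con 1 :* d)) :=
           α :* d :* (x :* b) :+ β :* γ :* b :* (y :* d)) refl α β γ x y b d ⟩
    α ⊛ d ⊛ (x ⊛ b) ⊕ β ⊛ γ ⊛ b ⊛ (y ⊛ d)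
      ≈⟨ +-cong (*-congˡ am≈xb) (*-congˡ cm≈yd) ⟨
    α ⊛ d ⊛ (a ⊛ m) ⊕ β ⊛ γ ⊛ b ⊛ (c ⊛ m)
      ≈⟨ solve 8 (λ α β γ a b c d m →
           α :* d :* (a :* m) :+ β :* γ :* b :* (c :* m) :=
           ((α :* a) :* (con 1 :* con 1 :* d) :+ (β :* γ :* c) :* (con 1 :* b)) :* m)
           refl α β γ a b c d m ⟩
    ((α ⊛ a) ⊛ (1# ⊛ 1# ⊛ d) ⊕ (β ⊛ γ ⊛ c) ⊛ (1# ⊛ b)) ⊛ m
      ∎

  -- Read as fractions: n / (m′ d) is extended by f to n f / (m d). It is used with m and m′
  -- consecutive factorials and f the last factor of m.
  /-cancelˡ : ∀ n m m′ f d → m ≈ m′ ⊛ f → n ⊛ (m ⊛ d) ≈ (n ⊛ f) ⊛ (m′ ⊛ d)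
  /-cancelˡ n m m′ f d m≈m′f = begin
    n ⊛ (m ⊛ d)          ≈⟨ *-congˡ (*-congʳ m≈m′f) ⟩
    n ⊛ (m′ ⊛ f ⊛ d)     ≈⟨ solve 4 (λ n m′ f d →
                              n :* (m′ :* f :* d) := (n :* f) :* (m′ :* d)) refl n m′ f d ⟩
    (n ⊛ f) ⊛ (m′ ⊛ d)   ∎

  /-cancelʳ : ∀ n m m′ f d → m ≈ m′ ⊛ f → n ⊛ (d ⊛ m) ≈ (n ⊛ f) ⊛ (d ⊛ m′)
  /-cancelʳ n m m′ f d m≈m′f = begin
    n ⊛ (d ⊛ m)          ≈⟨ *-congˡ (*-comm d m) ⟩
    n ⊛ (m ⊛ d)          ≈⟨ /-cancelˡ n m m′ f d m≈m′f ⟩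
    (n ⊛ f) ⊛ (m′ ⊛ d)   ≈⟨ *-congˡ (*-comm m′ d) ⟩
    (n ⊛ f) ⊛ (d ⊛ m′)   ∎

  -- Read as fractions: n / (n · 1) = 0 / 1 + 1 / 1, the shape taken by a coefficient whose two
  -- indices coincide.
  /-diagonal : ∀ n → n ⊛ (1# ⊛ 1#) ≈ (0# ⊛ 1# ⊕ 1# ⊛ 1#) ⊛ (n ⊛ 1#)
  /-diagonal = solve 1 (λ n →
    n :* (con 1 :* con 1) := (con 0 :* con 1 :+ con 1 :* con 1) :* (n :* con 1)) refl

  expand-last : ∀ α β γ n m f x y → n ≈ m ⊛ f → f ≈ α ⊛ x ⊕ β ⊛ γ ⊛ y →
                n ≈ α ⊛ (m ⊛ x) ⊕ β ⊛ γ ⊛ (m ⊛ y)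
  expand-last α β γ n m f x y n≈mf f≈ = begin
    n                                     ≈⟨ n≈mf ⟩
    m ⊛ f                                 ≈⟨ *-congˡ f≈ ⟩
    m ⊛ (α ⊛ x ⊕ β ⊛ γ ⊛ y)               ≈⟨ solve 6 (λ α β γ m x y →
                                               m :* (α :* x :+ β :* γ :* y) :=
                                               α :* (m :* x) :+ β :* γ :* (m :* y))
                                               refl α β γ m x y ⟩
    α ⊛ (m ⊛ x) ⊕ β ⊛ γ ⊛ (m ⊛ y)         ∎

-- Cancellation in ℤ[q] and the commutative semiring ℚ(q).

module ℤ[q]ᴿ = CommutativeRing ℤ[q]-commutativeRing

-- The difference p - r is killed by s, and ℤ[q] has no zero divisors. Transitivity of equality in
-- ℚ(q) rests on this.
*ₚ-cancelʳ : ∀ p r s → ¬ (s ≈ₚ []) → p *ₚ s ≈ₚ r *ₚ s → p ≈ₚ r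
*ₚ-cancelʳ p r s s≉0 ps≈rs with *-zero-factor (p +ₚ -ₚ r) s [p-r]s≈0
  where
  open import Algebra.Properties.Ring ℤ[q]ᴿ.ring
  open import Relation.Binary.Reasoning.Setoid ℤ[q]ᴿ.setoid
  [p-r]s≈0 : (p +ₚ -ₚ r) *ₚ s ≈ₚ []
  [p-r]s≈0 = begin
    (p +ₚ -ₚ r) *ₚ s           ≈⟨ [y-z]x≈yx-zx s p r ⟩
    p *ₚ s +ₚ -ₚ (r *ₚ s)      ≈⟨ ℤ[q]ᴿ.+-congʳ { -ₚ (r *ₚ s)} {p *ₚ s} {r *ₚ s} ps≈rs ⟩
    r *ₚ s +ₚ -ₚ (r *ₚ s)      ≈⟨ ℤ[q]ᴿ.-‿inverseʳ (r *ₚ s) ⟩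
    []                         ∎
... | inj₁ p-r≈0 = x∙y⁻¹≈ε⇒x≈y p r p-r≈0
  where open import Algebra.Properties.Group ℤ[q]ᴿ.+-group
... | inj₂ s≈0   = contradiction s≈0 s≉0

open FractionIdentities ℤ[q]ᴿ.commutativeSemiring

ℚ⟨q⟩-isEquivalence : IsEquivalence ℚ⟨q⟩._≈_
ℚ⟨q⟩-isEquivalence = record
  { refl  = λ _ → ≡.refl
  ; sym   = λ x≈y i → ≡.sym (x≈y i)
  ; trans = λ {x} {y} {z} x≈y y≈z →
      *ₚ-cancelʳ (num x *ₚ den z) (num z *ₚ den x) (den y) (den≉0 y)
        (swap-denominators (num x) (den x) (num y) (den y) (num z) (den z) x≈y y≈z)
  }

ℚ⟨q⟩-commutativeSemiring : CommutativeSemiring 0ℓ 0ℓ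
ℚ⟨q⟩-commutativeSemiring = record
  { Carrier = Frac
  ; _≈_     = ℚ⟨q⟩._≈_
  ; _+_     = ℚ⟨q⟩._+_
  ; _*_     = ℚ⟨q⟩._*_
  ; 0#      = ℚ⟨q⟩.0#
  ; 1#      = ℚ⟨q⟩.1#
  ; isCommutativeSemiring = isCommutativeSemiringˡ record
    { +-isCommutativeMonoid = isCommutativeMonoidˡ record
      { isSemigroup = record
        { isMagma = record
          { isEquivalence = ℚ⟨q⟩-isEquivalence
          ; ∙-cong        = λ {x} {x′} {y} {y′} →
              /-+-cong (num x) (den x) (num x′) (den x′) (num y) (den y) (num y′) (den y′)
          }
        ; assoc = λ x y z → /-+-assoc (num x) (den x) (num y) (den y) (num z) (den z)
        }
      ; identityˡ = λ x → /-+-identityˡ (num x) (den x)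
      ; comm      = λ x y → /-+-comm (num x) (den x) (num y) (den y)
      }
    ; *-isCommutativeMonoid = isCommutativeMonoidˡ record
      { isSemigroup = record
        { isMagma = record
          { isEquivalence = ℚ⟨q⟩-isEquivalence
          ; ∙-cong        = λ {x} {x′} {y} {y′} →
              /-*-cong (num x) (den x) (num x′) (den x′) (num y) (den y) (num y′) (den y′)
          }
        ; assoc = λ x y z → /-*-assoc (num x) (den x) (num y) (den y) (num z) (den z)
        }
      ; identityˡ = λ x → /-*-identityˡ (num x) (den x)
      ; comm      = λ x y → ℤ[q]ᴿ.*-cong {num x *ₚ num y} {num y *ₚ num x} {den y *ₚ den x} {den x *ₚ den y}
                              (ℤ[q]ᴿ.*-comm (num x) (num y)) (ℤ[q]ᴿ.*-comm (den y) (den x))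
      }
    ; distribʳ = λ x y z → /-distribʳ (num x) (den x) (num y) (den y) (num z) (den z)
    ; zeroˡ    = λ _ _ → ≡.refl
    }
  }
  where open import Algebra.Structures.Biased ℚ⟨q⟩._≈_

-- Geometric sums and the unfolding of a linear recurrence, over any commutative semiring.

module _ {c ℓ} (R : CommutativeSemiring c ℓ) where
  open CommutativeSemiring R renaming (_+_ to infixl 6 _⊕_; _*_ to infixl 7 _⊛_)
  open import Algebra.Properties.Semiring.Exp semiring
  open import Algebra.Properties.Semiring.Sum semiring
  open import Algebra.Solver.Ring.NaturalCoefficients.Default R
  open import Relation.Binary.Reasoning.Setoid setoid

  module Geometric (x : Carrier) where

    -- At x = q in ℤ[q], `geometric` is `[_]q` and `geometric^` is `[_]q^_`.
    geometric : ℕ → Carrier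
    geometric m = sum {m} (λ i → x ^ toℕ i)

    geometric^ : ℕ → ℕ → Carrier
    geometric^ m s = sum {m} (λ i → x ^ (s * toℕ i))

    geometric-+ : ∀ m n → geometric (m + n) ≈ geometric m ⊕ x ^ m ⊛ geometric n
    geometric-+ zero    n = sym (trans (+-identityˡ _) (*-identityˡ _))
    geometric-+ (suc m) n = begin
      1# ⊕ sum {m + n} (λ i → x ⊛ x ^ toℕ i)
        ≈⟨ +-congˡ (*-distribˡ-sum x (λ (i : Fin (m + n)) → x ^ toℕ i)) ⟨
      1# ⊕ x ⊛ geometric (m + n)
        ≈⟨ +-congˡ (*-congˡ (geometric-+ m n)) ⟩
      1# ⊕ x ⊛ (geometric m ⊕ x ^ m ⊛ geometric n)
        ≈⟨ solve 4 (λ x g y h →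
             con 1 :+ x :* (g :+ y :* h) := con 1 :+ x :* g :+ x :* y :* h)
             refl x (geometric m) (x ^ m) (geometric n) ⟩
      1# ⊕ x ⊛ geometric m ⊕ x ⊛ x ^ m ⊛ geometric n
        ≈⟨ +-congʳ (+-congˡ (*-distribˡ-sum x (λ (i : Fin m) → x ^ toℕ i))) ⟩
      geometric (suc m) ⊕ x ^ suc m ⊛ geometric n
        ∎

    geometric^-suc : ∀ m s → geometric^ (suc m) s ≈ 1# ⊕ x ^ s ⊛ geometric^ m s
    geometric^-suc m s = +-cong (^-congʳ x (ℕₚ.*-zeroʳ s)) (begin
      sum {m} (λ i → x ^ (s * suc (toℕ i)))
        ≈⟨ sum-cong-≋ (λ (i : Fin m) → trans (^-congʳ x (ℕₚ.*-suc s (toℕ i))) (^-homo-* x s _)) ⟩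
      sum {m} (λ i → x ^ s ⊛ x ^ (s * toℕ i))
        ≈⟨ *-distribˡ-sum (x ^ s) (λ (i : Fin m) → x ^ (s * toℕ i)) ⟨
      x ^ s ⊛ geometric^ m s
        ∎)

    -- The m * s powers fall into m blocks of s consecutive ones, and block i is x ^ (s * i) times
    -- the first block.
    geometric-* : ∀ m s → geometric (m * s) ≈ geometric^ m s ⊛ geometric s
    geometric-* zero    s = sym (zeroˡ _)
    geometric-* (suc m) s = begin
      geometric (s + m * s)
        ≈⟨ geometric-+ s (m * s) ⟩
      geometric s ⊕ x ^ s ⊛ geometric (m * s)
        ≈⟨ +-congˡ (*-congˡ (geometric-* m s)) ⟩
      geometric s ⊕ x ^ s ⊛ (geometric^ m s ⊛ geometric s)
        ≈⟨ solve 3 (λ g y h → g :+ y :* (h :* g) := (con 1 :+ y :* h) :* g)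
             refl (geometric s) (x ^ s) (geometric^ m s) ⟩
      (1# ⊕ x ^ s ⊛ geometric^ m s) ⊛ geometric s
        ≈⟨ *-congʳ (geometric^-suc m s) ⟨
      geometric^ (suc m) s ⊛ geometric s
        ∎

    geometric-*-+-* : ∀ a b c d →
      geometric (a * b + c * d) ≈
      geometric^ a b ⊛ geometric b ⊕ x ^ (a * b) ⊛ geometric^ d c ⊛ geometric c
    geometric-*-+-* a b c d = begin
      geometric (a * b + c * d)
        ≈⟨ geometric-+ (a * b) (c * d) ⟩
      geometric (a * b) ⊕ x ^ (a * b) ⊛ geometric (c * d)
        -- The second product is cut into d blocks of length c, so that the factor split off is
        -- `geometric c`; with c = F k this is the [F k] needed later.
        ≡⟨ cong (λ n → geometric (a * b) ⊕ x ^ (a * b) ⊛ geometric n) (ℕₚ.*-comm c d) ⟩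
      geometric (a * b) ⊕ x ^ (a * b) ⊛ geometric (d * c)
        ≈⟨ +-cong (geometric-* a b) (*-congˡ (geometric-* d c)) ⟩
      geometric^ a b ⊛ geometric b ⊕ x ^ (a * b) ⊛ (geometric^ d c ⊛ geometric c)
        ≈⟨ +-congˡ (*-assoc _ _ _) ⟨
      geometric^ a b ⊛ geometric b ⊕ x ^ (a * b) ⊛ geometric^ d c ⊛ geometric c
        ∎

  -- Substituting the expansion of z into one step of the recurrence for x. The recurrence's own
  -- second term becomes the summand at index 0, its factor `1#` being the empty product; the old
  -- summands move up by one index, and α joins their products.
  unfold-step : ∀ {m} x α z p p′ β γ y (b c r r′ φ : Fin m → Carrier) →
    x ≈ α ⊛ z ⊕ β ⊛ γ ⊛ y →
    z ≈ sum (λ i → b i ⊛ c i ⊛ r i ⊛ φ i) ⊕ p →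
    α ⊛ p ≈ p′ → (∀ i → α ⊛ r i ≈ r′ i) →
    x ≈ (β ⊛ γ ⊛ 1# ⊛ y ⊕ sum (λ i → b i ⊛ c i ⊛ r′ i ⊛ φ i)) ⊕ p′
  unfold-step x α z p p′ β γ y b c r r′ φ x≈ z≈ αp≈p′ αr≈r′ = begin
    x
      ≈⟨ x≈ ⟩
    α ⊛ z ⊕ β ⊛ γ ⊛ y
      ≈⟨ +-congʳ (*-congˡ z≈) ⟩
    α ⊛ (sum s ⊕ p) ⊕ β ⊛ γ ⊛ y
      ≈⟨ solve 6 (λ α s p β γ y →
           α :* (s :+ p) :+ β :* γ :* y := (β :* γ :* con 1 :* y :+ α :* s) :+ α :* p)
           refl α (sum s) p β γ y ⟩
    (β ⊛ γ ⊛ 1# ⊛ y ⊕ α ⊛ sum s) ⊕ α ⊛ p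
      ≈⟨ +-cong (+-congˡ (trans (*-distribˡ-sum α s) (sum-cong-≋ αs≈s′))) αp≈p′ ⟩
    (β ⊛ γ ⊛ 1# ⊛ y ⊕ sum s′) ⊕ p′
      ∎
    where
    s s′ : Fin _ → Carrier
    s  i = b i ⊛ c i ⊛ r i ⊛ φ i
    s′ i = b i ⊛ c i ⊛ r′ i ⊛ φ i
    αs≈s′ : ∀ i → α ⊛ s i ≈ s′ i
    αs≈s′ i = begin
      α ⊛ (b i ⊛ c i ⊛ r i ⊛ φ i)
        ≈⟨ solve 5 (λ α b c r φ → α :* (b :* c :* r :* φ) := b :* c :* (α :* r) :* φ)
             refl α (b i) (c i) (r i) (φ i) ⟩
      b i ⊛ c i ⊛ (α ⊛ r i) ⊛ φ i
        ≈⟨ *-congʳ (*-congˡ (αr≈r′ i)) ⟩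
      b i ⊛ c i ⊛ r′ i ⊛ φ i
        ∎

  -- The step from d = 0 to d = 1: the second term of the recurrence carries [F 0] = 0, so the sum
  -- stays empty.
  unfold-last : ∀ x α z p p′ β y → x ≈ α ⊛ z ⊕ β ⊛ 0# ⊛ y → z ≈ 0# ⊕ p →
                α ⊛ p ≈ p′ → x ≈ 0# ⊕ p′
  unfold-last x α z p p′ β y x≈ z≈ αp≈p′ = begin
    x                                 ≈⟨ x≈ ⟩
    α ⊛ z ⊕ β ⊛ 0# ⊛ y                ≈⟨ +-congʳ (*-congˡ z≈) ⟩
    α ⊛ (0# ⊕ p) ⊕ β ⊛ 0# ⊛ y         ≈⟨ solve 4 (λ α p β y →
                                           α :* (con 0 :+ p) :+ β :* con 0 :* y :=
                                           con 0 :+ α :* p) refl α p β y ⟩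
    0# ⊕ α ⊛ p                        ≈⟨ +-congˡ αp≈p′ ⟩
    0# ⊕ p′                           ∎

-- The addition formula for Fibonacci numbers and its q-analogue.

-- Induction on m for all n at once: `suc m + n` is read as `m + suc n`, and the Fibonacci rule
-- regroups the products.
F-+ : ∀ m n → F (suc (m + n)) ≡ F (suc m) * F (suc n) + F m * F n
F-+ zero    n = ≡.sym (≡.trans (ℕₚ.+-identityʳ _) (ℕₚ.*-identityˡ _))
F-+ (suc m) n = begin
  F (suc (suc (m + n)))
    ≡⟨ cong (λ l → F (suc l)) (ℕₚ.+-suc m n) ⟨
  F (suc (m + suc n))
    ≡⟨ F-+ m (suc n) ⟩
  F (suc m) * (F (suc n) + F n) + F m * F (suc n)
    ≡⟨ solve 4 (λ a b c d → a :* (c :+ d) :+ b :* c := (a :+ b) :* c :+ a :* d)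
         ≡.refl (F (suc m)) (F m) (F (suc n)) (F n) ⟩
  (F (suc m) + F m) * F (suc n) + F (suc m) * F n
    ∎
  where
  open ≡-Reasoning
  open import Data.Nat.Solver using (module +-*-Solver)
  open +-*-Solver

-- Here d = `suc e`. The first F (k + 1) F d powers of q form blocks of length F d, the remaining F
-- k F (d - 1) form blocks of length F k. The index is spelled `e + 1` in one place because n - k -
-- j + 1 reduces to that form at j = 1.
[F-+]q : ∀ e k →
  [ F (suc (e + k)) ]q ≈ₚ
  ([ F (k + 1) ]q^ F (e + 1)) *ₚ [ F (suc e) ]q +ₚ
  q ℤ[q].^ (F (k + 1) * F (suc e)) *ₚ ([ F e ]q^ F k) *ₚ [ F k ]q
[F-+]q e k rewrite ℕₚ.+-comm k 1 | ℕₚ.+-comm e 1 | F-+ e k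
  | ℕₚ.*-comm (F (suc e)) (F (suc k)) | ℕₚ.*-comm (F e) (F k) =
  Geometric.geometric-*-+-* ℤ[q]ᴿ.commutativeSemiring q (F (suc k)) (F (suc e)) (F k) (F e)

-- The Pascal-type recurrence for q-Fibonomial coefficients.

-- `ℤ[q].product` unfolds at its first factor, whereas the recurrence needs the last one. The
-- library's lemmas on sums are applied to the multiplicative monoid.
[F_]!-suc : ∀ m → [F suc m ]! ≈ₚ [F m ]! *ₚ [ F (suc m) ]q
[F m ]!-suc = begin
  [F suc m ]!
    ≈⟨ sum-init-last {m} (λ i → [ F (suc (toℕ i)) ]q) ⟩
  ℤ[q].product {m} (λ i → [ F (suc (toℕ (inject₁ i))) ]q) *ₚ [ F (suc (toℕ (fromℕ m))) ]q
    ≡⟨ cong₂ _*ₚ_ (sum-cong-≗ {m} (λ i → cong (λ l → [ F (suc l) ]q) (toℕ-inject₁ i)))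
                  (cong (λ l → [ F (suc l) ]q) (toℕ-fromℕ m)) ⟩
  [F m ]! *ₚ [ F (suc m) ]q
    ∎
  where
  open import Algebra.Properties.Monoid.Sum ℤ[q]ᴿ.*-monoid
  open import Relation.Binary.Reasoning.Setoid ℤ[q]ᴿ.setoid

-- As fractions: the coefficient at (n , k - 1) equals [F n]! [F k] / ([F k]! [F (n + 1 - k)]!). For
-- k = 0 both sides vanish, since F 0 = 0 matches the value 0 at lower index -1.
absorb-lower : ∀ n k →
  num (fibonomial n (+ k ℤ.- 1ℤ)) *ₚ ([F k ]! *ₚ [F suc n ∸ k ]!) ≈ₚ
  ([F n ]! *ₚ [ F k ]q) *ₚ den (fibonomial n (+ k ℤ.- 1ℤ))
absorb-lower n zero = begin
  []                                     ≈⟨ ℤ[q]ᴿ.zeroˡ ℤ[q].1# ⟨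
  [] *ₚ ℤ[q].1#                          ≈⟨ ℤ[q]ᴿ.*-congʳ {ℤ[q].1#} {[F n ]! *ₚ []} {[]} (ℤ[q]ᴿ.zeroʳ [F n ]!) ⟨
  ([F n ]! *ₚ []) *ₚ ℤ[q].1#             ∎
  where open import Relation.Binary.Reasoning.Setoid ℤ[q]ᴿ.setoid
absorb-lower n (suc k) =
  /-cancelˡ [F n ]! [F suc k ]! [F k ]! [ F (suc k) ]q [F n ∸ k ]! [F k ]!-suc

-- As fractions, with d = `suc e` and n = d + k: the coefficient at (n - 1 , k) equals [F (n - 1)]!
-- [F d] / ([F k]! [F d]!).
absorb-upper : ∀ e k →
  [F e + k ]! *ₚ ([F k ]! *ₚ [F suc (e + k) ∸ k ]!) ≈ₚ
  ([F e + k ]! *ₚ [ F (suc e) ]q) *ₚ ([F k ]! *ₚ [F e + k ∸ k ]!)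
absorb-upper e k
  rewrite ℕₚ.m+n∸n≡m (suc e) k | ℕₚ.m+n∸n≡m e k =
  /-cancelʳ [F e + k ]! [F suc e ]! [F e ]! [ F (suc e) ]q [F k ]! [F e ]!-suc

fibonomial-recurrence : ∀ e k →
  fibonomial (suc e + k) (+ k) ℚ⟨q⟩.≈
    ι ([ F (k + 1) ]q^ F (e + 1)) ℚ⟨q⟩.* fibonomial (e + k) (+ k)
    ℚ⟨q⟩.+ ι (q ℤ[q].^ (F (k + 1) * F (suc e))) ℚ⟨q⟩.* ι ([ F e ]q^ F k)
           ℚ⟨q⟩.* fibonomial (e + k) (+ k ℤ.- 1ℤ)
fibonomial-recurrence e k =
  /-common-denominator α β γ [F suc e + k ]! ([F k ]! *ₚ [F suc e + k ∸ k ]!)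
    ([F e + k ]! *ₚ [ F (suc e) ]q) ([F e + k ]! *ₚ [ F k ]q)
    [F e + k ]! ([F k ]! *ₚ [F e + k ∸ k ]!)
    (num (fibonomial (e + k) (+ k ℤ.- 1ℤ))) (den (fibonomial (e + k) (+ k ℤ.- 1ℤ)))
    (absorb-upper e k) (absorb-lower (e + k) k)
    -- With both coefficients over the denominator [F k]! [F d]!, only the numerators remain to be
    -- compared: the last factor of [F n]! is split by the q-addition formula.
    (expand-last α β γ [F suc e + k ]! [F e + k ]! [ F (suc (e + k)) ]q [ F (suc e) ]q [ F k ]q
      [F e + k ]!-suc ([F-+]q e k))
  where
  α β γ : Poly
  α = [ F (k + 1) ]q^ F (e + 1)
  β = q ℤ[q].^ (F (k + 1) * F (suc e))
  γ = [ F e ]q^ F k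

fibonomial-diagonal : ∀ k → fibonomial k (+ k) ℚ⟨q⟩.≈ ℚ⟨q⟩.0# ℚ⟨q⟩.+ ι ℤ[q].1#
fibonomial-diagonal k rewrite ℕₚ.n∸n≡0 k = /-diagonal [F k ]!

-- Unfolding the recurrence into the sum.

ι-* : ∀ p r → ι p ℚ⟨q⟩.* ι r ℚ⟨q⟩.≈ ι (p *ₚ r)
ι-* p r i = ≡.sym (*-congˡ {p *ₚ r} {ℤ[q].1# *ₚ ℤ[q].1#} {ℤ[q].1#} (*-identityˡ ℤ[q].1#) i)
  where open ℤ[q]ᴿ using (*-congˡ; *-identityˡ)

-- With d in place of n - k, `factor (suc d) k (suc j)` reduces to `factor d k j`. Putting
-- `factor (suc d) k 1` in front of a product for d therefore gives the product for `suc d` by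
-- computation.
factor : ℕ → ℕ → ℕ → Poly
factor d k j = [ F (k + 1) ]q^ F (d ∸ j + 1)

summand : ℕ → ℕ → ℕ → Frac
summand d k i =
  ι (q ℤ[q].^ (F (k + 1) * F (d ∸ i)))
  ℚ⟨q⟩.* ι ([ F (d ∸ i ∸ 1) ]q^ F k)
  ℚ⟨q⟩.* ι (∏[1≤ j ≤ i ] factor d k j)
  ℚ⟨q⟩.* fibonomial (d + k ∸ i ∸ 1) (+ k ℤ.- 1ℤ)

-- Induction on d. The case d = 1 stands apart because the upper limit `d ∸ 1` is 0 for both d = 0
-- and d = 1.
fibonomial-expansion : ∀ d k →
  fibonomial (d + k) (+ k) ℚ⟨q⟩.≈
  (∑[ i < d ∸ 1 ] summand d k i) ℚ⟨q⟩.+ ι (∏[1≤ j ≤ d ] factor d k j)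
fibonomial-expansion zero k = fibonomial-diagonal k
fibonomial-expansion (suc zero) k =
  unfold-last ℚ⟨q⟩-commutativeSemiring
    (fibonomial (suc k) (+ k)) (ι (factor 1 k 1)) (fibonomial k (+ k)) (ι ℤ[q].1#)
    (ι (∏[1≤ j ≤ 1 ] factor 1 k j))
    (ι (q ℤ[q].^ (F (k + 1) * F 1))) (fibonomial k (+ k ℤ.- 1ℤ))
    (fibonomial-recurrence 0 k) (fibonomial-expansion 0 k) (ι-* (factor 1 k 1) ℤ[q].1#)
fibonomial-expansion (suc (suc e)) k =
  unfold-step ℚ⟨q⟩-commutativeSemiring {e}
    (fibonomial (suc (suc e) + k) (+ k)) (ι (factor (suc (suc e)) k 1))
    (fibonomial (suc e + k) (+ k))
    (ι (∏[1≤ j ≤ suc e ] factor (suc e) k j))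
    (ι (∏[1≤ j ≤ suc (suc e) ] factor (suc (suc e)) k j))
    (ι (q ℤ[q].^ (F (k + 1) * F (suc (suc e))))) (ι ([ F (suc e) ]q^ F k))
    (fibonomial (suc e + k) (+ k ℤ.- 1ℤ))
    -- The powers, brackets and coefficients at index i for `suc e` reappear unchanged at index i +
    -- 1 for `suc (suc e)`; only the product gains a factor.
    (λ i → ι (q ℤ[q].^ (F (k + 1) * F (suc e ∸ toℕ i))))
    (λ i → ι ([ F (suc e ∸ toℕ i ∸ 1) ]q^ F k))
    (λ i → ι (∏[1≤ j ≤ toℕ i ] factor (suc e) k j))
    (λ i → ι (∏[1≤ j ≤ suc (toℕ i) ] factor (suc (suc e)) k j))
    (λ i → fibonomial (suc e + k ∸ toℕ i ∸ 1) (+ k ℤ.- 1ℤ))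
    (fibonomial-recurrence (suc e) k)
    (fibonomial-expansion (suc e) k)
    (ι-* (factor (suc (suc e)) k 1) (∏[1≤ j ≤ suc e ] factor (suc e) k j))
    (λ i → ι-* (factor (suc (suc e)) k 1) (∏[1≤ j ≤ toℕ i ] factor (suc e) k j))

proposition3p5 : ∀ (n k : ℕ) → 1 ≤ n → k ≤ n →
    fibonomial n (+ k) ℚ⟨q⟩.≈
      (∑[ i < n ∸ k ∸ 1 ]
        (ι (q ℤ[q].^ (F (k + 1) * F (n ∸ k ∸ i)))
          ℚ⟨q⟩.* ι ([ F (n ∸ k ∸ i ∸ 1) ]q^ F k)
          ℚ⟨q⟩.* ι (∏[1≤ j ≤ i ] ([ F (k + 1) ]q^ F (n ∸ k ∸ j + 1)))
          ℚ⟨q⟩.* fibonomial (n ∸ i ∸ 1) (+ k ℤ.- 1ℤ)))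
      ℚ⟨q⟩.+ ι (∏[1≤ j ≤ n ∸ k ] ([ F (k + 1) ]q^ F (n ∸ k ∸ j + 1)))
proposition3p5 n k _ k≤n = ≡.subst
  -- Only the upper indices of the coefficients are rewritten from `n ∸ k + k` to n; every `n ∸ k`
  -- already plays the part of d.
  (λ m → fibonomial m (+ k) ℚ⟨q⟩.≈
    (∑[ i < n ∸ k ∸ 1 ]
      (ι (q ℤ[q].^ (F (k + 1) * F (n ∸ k ∸ i)))
        ℚ⟨q⟩.* ι ([ F (n ∸ k ∸ i ∸ 1) ]q^ F k)
        ℚ⟨q⟩.* ι (∏[1≤ j ≤ i ] factor (n ∸ k) k j)
        ℚ⟨q⟩.* fibonomial (m ∸ i ∸ 1) (+ k ℤ.- 1ℤ)))
    ℚ⟨q⟩.+ ι (∏[1≤ j ≤ n ∸ k ] factor (n ∸ k) k j))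
  (ℕₚ.m∸n+n≡m k≤n) (fibonomial-expansion (n ∸ k) k)
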